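{- Let $G$ be a finite simple graph with stability number $\alpha(G)\leq 3$, and let $G^{\ast}$ be the graph obtained from $G$ by appending a single pendant edge to each vertex of $G$. Then the independence polynomial $I(G^{\ast};x)$ is log-concave.
   Context: All graphs are finite, undirected, without loops or multiple edges, and have at least one vertex. A stable set in a graph $G$ is a set of pairwise non-adjacent vertices; the stability number $\alpha(G)$ is the maximum size of a stable set in $G$. Let $s_k$ be the number of stable sets of cardinality $k$ in $G$ (so $s_0=1$); the independence polynomial of $G$ is $I(G;x)=\sum_{k=0}^{\alpha(G)}s_kx^k$. The graph $G^{\ast}$ is obtained from $G$ by adding, for each vertex $v$ of $G$, one new vertex $v'$ joined only to $v$. A finite sequence of real numbers $(a_0,a_1,\dots,a_n)$ is log-concave if $a_i^2\geq a_{i-1}a_{i+1}$ for all $1\leq i\leq n-1$; a polynomial is log-concave if its sequence of coefficients is log-concave. -}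

module Defs where

open import Data.Empty using (⊥; ⊥-elim)
open import Data.Fin.Base using (Fin; toℕ; splitAt)
open import Data.Fin.Properties using (_≟_; all?)
open import Data.Fin.Subset using (Subset; inside; outside; _∈_; ∣_∣)
open import Data.Fin.Subset.Properties using (_∈?_)
open import Data.List.Base using (List; []; _∷_; _++_; map; filter; length)
open import Data.List.Extrema.Nat using (max)
open import Data.List.Membership.Propositional as List using ()
open import Data.List.Membership.Propositional.Properties
  using (∈-++⁺ˡ; ∈-++⁺ʳ; ∈-map⁺; ∈-map⁻)
open import Data.List.Relation.Unary.All as All using ()
open import Data.List.Relation.Unary.AllPairs as AllPairs using ()
open import Data.List.Relation.Unary.Any using (here)
open import Data.List.Relation.Unary.Unique.Propositional using (Unique)
open import Data.List.Relation.Unary.Unique.Propositional.Properties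
  using (++⁺; map⁺)
open import Data.Nat.Base using (ℕ; zero; suc; _+_; _*_; _^_; _≤_; NonZero)
import Data.Nat.Properties as ℕ
open import Data.Product.Base using (_×_; _,_)
open import Data.Sum.Base using (_⊎_; inj₁; inj₂)
open import Data.Vec.Base as Vec using ()
open import Data.Vec.Functional using (Vector)
open import Data.Vec.Properties using (∷-injectiveʳ)
open import Level using (0ℓ)
open import Relation.Binary.Core using (Rel)
open import Relation.Binary.Definitions using (Symmetric; Decidable)
open import Relation.Binary.PropositionalEquality using (_≡_; refl; sym)
open import Relation.Nullary.Decidable using (Dec; no; ¬?; _→-dec_)
open import Relation.Nullary.Negation using (¬_)

record Graph : Set₁ where
  field
    order    : ℕ
    nonEmpty : NonZero order
    Adj      : Rel (Fin order) 0ℓ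
    adj?     : Decidable Adj
    adj-sym  : Symmetric Adj
    loopless : ∀ v → ¬ Adj v v

module _ (G : Graph) where
  open Graph G

  Stable : Subset order → Set
  Stable S = ∀ u v → u ∈ S → v ∈ S → ¬ Adj u v

  stable? : ∀ S → Dec (Stable S)
  stable? S = all? λ u → all? λ v →
    (u ∈? S) →-dec ((v ∈? S) →-dec ¬? (adj? u v))

allSubsets : ∀ n → List (Subset n)
allSubsets zero    = Vec.[] ∷ []
allSubsets (suc n) = map (inside Vec.∷_) (allSubsets n)
                  ++ map (outside Vec.∷_) (allSubsets n)

-- The next two facts say that counting entries of allSubsets n is counting
-- subsets of Fin n.

∈-allSubsets : ∀ {n} (S : Subset n) → S List.∈ allSubsets n
∈-allSubsets Vec.[]            = here refl
∈-allSubsets (inside Vec.∷ S)  =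
  ∈-++⁺ˡ (∈-map⁺ (inside Vec.∷_) (∈-allSubsets S))
∈-allSubsets {suc n} (outside Vec.∷ S) =
  ∈-++⁺ʳ (map (inside Vec.∷_) (allSubsets n))
         (∈-map⁺ (outside Vec.∷_) (∈-allSubsets S))

allSubsets-unique : ∀ n → Unique (allSubsets n)
allSubsets-unique zero    = All.[] AllPairs.∷ AllPairs.[]
allSubsets-unique (suc n) =
  ++⁺ (map⁺ ∷-injectiveʳ (allSubsets-unique n))
      (map⁺ ∷-injectiveʳ (allSubsets-unique n))
      disjoint
  where
  disjoint : ∀ {S} → ¬ (S List.∈ map (inside Vec.∷_) (allSubsets n)
                      × S List.∈ map (outside Vec.∷_) (allSubsets n))
  disjoint (p , q) with ∈-map⁻ (inside Vec.∷_) p | ∈-map⁻ (outside Vec.∷_) q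
  ... | _ , _ , refl | _ , _ , ()

module _ (G : Graph) where
  open Graph G

  stableSets : List (Subset order)
  stableSets = filter (stable? G) (allSubsets order)

  -- The base value 0 does not affect the maximum, the empty set being stable.
  α : ℕ
  α = max 0 (map ∣_∣ stableSets)

  s : ℕ → ℕ
  s k = length (filter (λ S → ∣ S ∣ ℕ.≟ k) stableSets)

  -- A polynomial a₀ + a₁x + ⋯ + aₙxⁿ is represented by its coefficient
  -- sequence, an element of Vector ℕ (suc n).
  independencePolynomial : Vector ℕ (suc α)
  independencePolynomial k = s (toℕ k)

-- i, j, k range over the consecutive triples of indices, j being the interior
-- one.
LogConcave : ∀ {n} → Vector ℕ (suc n) → Set
LogConcave {n} a = ∀ (i j k : Fin (suc n)) →
  toℕ j ≡ suc (toℕ i) → toℕ k ≡ suc (toℕ j) → a i * a k ≤ a j ^ 2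

-- In G *ᴳ, the vertices of G are the first half of Fin (order + order), and the
-- new vertex v′ is v shifted by order; splitAt recovers inj₁ v and inj₂ v.
module _ (G : Graph) where
  open Graph G

  Adj⊎ : Rel (Fin order ⊎ Fin order) 0ℓ
  Adj⊎ (inj₁ u) (inj₁ v) = Adj u v
  Adj⊎ (inj₁ u) (inj₂ v) = u ≡ v
  Adj⊎ (inj₂ u) (inj₁ v) = u ≡ v
  Adj⊎ (inj₂ u) (inj₂ v) = ⊥

  adj⊎? : Decidable Adj⊎
  adj⊎? (inj₁ u) (inj₁ v) = adj? u v
  adj⊎? (inj₁ u) (inj₂ v) = u ≟ v
  adj⊎? (inj₂ u) (inj₁ v) = u ≟ v
  adj⊎? (inj₂ u) (inj₂ v) = no λ ()

  adj⊎-sym : Symmetric Adj⊎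
  adj⊎-sym {inj₁ u} {inj₁ v} = adj-sym
  adj⊎-sym {inj₁ u} {inj₂ v} = sym
  adj⊎-sym {inj₂ u} {inj₁ v} = sym
  adj⊎-sym {inj₂ u} {inj₂ v} = ⊥-elim

  adj⊎-loopless : ∀ x → ¬ Adj⊎ x x
  adj⊎-loopless (inj₁ v) = loopless v
  adj⊎-loopless (inj₂ v) = ⊥-elim

infix 8 _*ᴳ

_*ᴳ : Graph → Graph
G *ᴳ = record
  { order    = order + order
  ; nonEmpty = +-nonZero nonEmpty
  ; Adj      = λ x y → Adj⊎ G (splitAt order x) (splitAt order y)
  ; adj?     = λ x y → adj⊎? G (splitAt order x) (splitAt order y)
  ; adj-sym  = λ {x} {y} → adj⊎-sym G {splitAt order x} {splitAt order y}
  ; loopless = λ x → adj⊎-loopless G (splitAt order x)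
  }
  where
  open Graph G
  +-nonZero : ∀ {m n} → NonZero m → NonZero (m + n)
  +-nonZero {suc m} _ = _

{-# OPTIONS --safe #-}
-- If G has n vertices, the coefficient of xᵏ in I(G*;x) is Σⱼ sⱼ C(n−j,k−j),
-- and n! times it is C(n,k)·f(k) with f(k) = Σⱼ sⱼ (n−j)! k(k−1)⋯(k−j+1).  The
-- binomial factor is log-concave in k.  As α(G) ≤ 3, f(k) is the polynomial
-- a(1+k) + b k(k−1) + c k(k−1)(k−2) with a = n!, b = s₂(n−2)!, c = s₃(n−3)!, and
-- the bounds (j+1)sⱼ₊₁ ≤ (n−j)sⱼ, valid for any family of sets closed under
-- subsets, give 2b ≤ a and 3c ≤ b, which make f log-concave.
module Submission where

open import Defs
open import Data.Bool.Base using (Bool; true; false; if_then_else_)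
open import Data.Fin.Base using (Fin; toℕ; splitAt; join)
open import Data.Fin.Properties using (_≟_; splitAt-join)
open import Data.Fin.Subset
  using (Subset; inside; outside; _∈_; _⊆_; ∣_∣; ∁; ⊤)
open import Data.Fin.Subset.Properties
  using (_⊆?_; out⊆; in⊆in; ∣∁p∣≡n∸∣p∣; ∣p∣≤n; ∣⊤∣≡n; ⊆⊤; x∈p⇒∣p-x∣<∣p∣;
         x∈p∧x≢y⇒x∈p-y; x∈∁p⇒x∉p; x∉p⇒x∈∁p)
import Data.List.Base as List
open import Data.List.Extrema.Nat using (xs≤max)
open import Data.List.Membership.Propositional.Properties using (∈-map⁺; ∈-filter⁺)
open import Data.List.Properties using (map-++; map-∘)
import Data.List.Relation.Unary.All as All
open import Data.Nat.Base
open import Data.Nat.Combinatorics using (_C_; nCk+nC[k+1]≡[n+1]C[k+1]; nC1≡n)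
open import Data.Nat.Combinatorics.Base using (_P′_)
open import Data.Nat.Combinatorics.Specification using (nP′k≡n[n∸1P′k∸1])
open import Data.Nat.ListAction using (sum)
open import Data.Nat.ListAction.Properties using (sum-++)
open import Data.Nat.Properties hiding (_≟_)
import Data.Nat.Properties as ℕ
open import Data.Nat.Tactic.RingSolver using (solve-∀)
open import Data.Product.Base using (_×_; _,_)
open import Data.Sum.Base using (_⊎_; inj₁; inj₂; [_,_]′)
open import Data.Vec.Base as Vec using ([]; _∷_; _++_)
open import Data.Vec.Properties using ([]=⇒lookup; lookup⇒[]=; lookup-splitAt)
open import Function.Base using (_∘_)
open import Function.Bundles using (_⇔_; mk⇔; Equivalence)
open import Level using (0ℓ)
open import Relation.Binary.PropositionalEquality
  using (_≡_; refl; sym; trans; cong; cong₂; subst; subst₂; module ≡-Reasoning)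
open import Relation.Nullary.Decidable using (Dec; yes; no; does; does-⇔; dec-true; _×-dec_)
open import Relation.Nullary.Negation using (¬_; contradiction)
open import Relation.Unary using (Pred; Decidable)

-- Indicators of decidable propositions

⟦_⟧ : Bool → ℕ
⟦ b ⟧ = if b then 1 else 0

⟦⟧-mono : ∀ {P Q : Set} (P? : Dec P) (Q? : Dec Q) → (P → Q) →
          ⟦ does P? ⟧ ≤ ⟦ does Q? ⟧
⟦⟧-mono (no _)  _       _   = z≤n
⟦⟧-mono (yes _) (yes _) _   = ≤-refl
⟦⟧-mono (yes p) (no ¬q) P⇒Q = contradiction (P⇒Q p) ¬q

⟦⟧-× : ∀ {P Q : Set} (P? : Dec P) (Q? : Dec Q) →
       ⟦ does (P? ×-dec Q?) ⟧ ≡ ⟦ does P? ⟧ * ⟦ does Q? ⟧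
⟦⟧-× (no _)  _       = refl
⟦⟧-× (yes _) (yes _) = refl
⟦⟧-× (yes _) (no _)  = refl

-- Sums over all subsets of a finite set

-- Recursion on the first point makes every induction below a case split on its membership;
-- `sum-allSubsets` returns to the list in terms of which `s` is defined.
∑ : ∀ {n} → (Subset n → ℕ) → ℕ
∑ {zero}  f = f []
∑ {suc n} f = ∑ (f ∘ (inside ∷_)) + ∑ (f ∘ (outside ∷_))

∑-cong : ∀ {n} {f g : Subset n → ℕ} → (∀ S → f S ≡ g S) → ∑ f ≡ ∑ g
∑-cong {zero}  f≗g = f≗g []
∑-cong {suc n} f≗g = cong₂ _+_ (∑-cong (f≗g ∘ (inside ∷_))) (∑-cong (f≗g ∘ (outside ∷_)))

∑-mono : ∀ {n} {f g : Subset n → ℕ} → (∀ S → f S ≤ g S) → ∑ f ≤ ∑ g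
∑-mono {zero}  f≤g = f≤g []
∑-mono {suc n} f≤g = +-mono-≤ (∑-mono (f≤g ∘ (inside ∷_))) (∑-mono (f≤g ∘ (outside ∷_)))

∑-+ : ∀ {n} (f g : Subset n → ℕ) → ∑ (λ S → f S + g S) ≡ ∑ f + ∑ g
∑-+ {zero}  f g = refl
∑-+ {suc n} f g = trans
  (cong₂ _+_ (∑-+ (f ∘ (inside ∷_)) (g ∘ (inside ∷_)))
             (∑-+ (f ∘ (outside ∷_)) (g ∘ (outside ∷_))))
  (interchange (∑ (f ∘ (inside ∷_))) _ _ _)
  where
  interchange : ∀ a b c d → (a + b) + (c + d) ≡ (a + c) + (b + d)
  interchange = solve-∀

∑-*ˡ : ∀ {n} c (f : Subset n → ℕ) → ∑ (λ S → c * f S) ≡ c * ∑ f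
∑-*ˡ {zero}  c f = refl
∑-*ˡ {suc n} c f = trans
  (cong₂ _+_ (∑-*ˡ c (f ∘ (inside ∷_))) (∑-*ˡ c (f ∘ (outside ∷_))))
  (sym (*-distribˡ-+ c _ _))

∑-0 : ∀ {n} {f : Subset n → ℕ} → (∀ S → f S ≡ 0) → ∑ f ≡ 0
∑-0 {n} f≗0 = trans (∑-cong f≗0) (∑-*ˡ {n} 0 (λ _ → 0))

∑-++ : ∀ m {n} (f : Subset (m + n) → ℕ) → ∑ f ≡ ∑ {m} λ A → ∑ {n} λ B → f (A ++ B)
∑-++ zero    f = refl
∑-++ (suc m) f = cong₂ _+_ (∑-++ m _) (∑-++ m _)

sum-allSubsets : ∀ n (f : Subset n → ℕ) → sum (List.map f (allSubsets n)) ≡ ∑ f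
sum-allSubsets zero    f = +-identityʳ (f [])
sum-allSubsets (suc n) f = begin
  sum (List.map f (List.map (inside ∷_) as List.++ List.map (outside ∷_) as))
    ≡⟨ cong sum (map-++ f (List.map (inside ∷_) as) _) ⟩
  sum (List.map f (List.map (inside ∷_) as) List.++ List.map f (List.map (outside ∷_) as))
    ≡⟨ sum-++ (List.map f (List.map (inside ∷_) as)) _ ⟩
  sum (List.map f (List.map (inside ∷_) as)) + sum (List.map f (List.map (outside ∷_) as))
    ≡⟨ cong₂ _+_ (half inside) (half outside) ⟩
  ∑ f ∎
  where
  open ≡-Reasoning
  as = allSubsets n
  half : ∀ b → sum (List.map f (List.map (b ∷_) as)) ≡ ∑ (f ∘ (b ∷_))
  half b = trans (cong sum (sym (map-∘ as))) (sum-allSubsets n (f ∘ (b ∷_)))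

length-filter-filter : ∀ {A : Set} {P Q : Pred A 0ℓ} (P? : Decidable P) (Q? : Decidable Q) xs →
  List.length (List.filter P? (List.filter Q? xs)) ≡
  sum (List.map (λ x → ⟦ does (Q? x) ⟧ * ⟦ does (P? x) ⟧) xs)
length-filter-filter P? Q? List.[] = refl
length-filter-filter P? Q? (x List.∷ xs) with does (Q? x)
... | false = length-filter-filter P? Q? xs
... | true with does (P? x)
...   | false = length-filter-filter P? Q? xs
...   | true  = cong suc (length-filter-filter P? Q? xs)

-- Weighted level sums

-- For `w` the indicator of a family of sets, these are the numbers of members of each size. Since
-- `≡ᵇ` computes, `level w (suc j)` unfolds to level `j` of the link of the first point plus level
-- `suc j` of its deletion.
level : ∀ {n} → (Subset n → ℕ) → ℕ → ℕ
level w j = ∑ λ S → w S * ⟦ ∣ S ∣ ≡ᵇ j ⟧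

level-inside-0 : ∀ {n} (w : Subset (suc n) → ℕ) →
                 ∑ (λ S → w (inside ∷ S) * ⟦ ∣ inside ∷ S ∣ ≡ᵇ 0 ⟧) ≡ 0
level-inside-0 w = ∑-0 λ S → *-zeroʳ (w (inside ∷ S))

-- The link and the deletion of the first point both satisfy the inequality,
-- and the levels of the link are dominated by those of the deletion.
level-shadow : ∀ {n} (w : Subset n → ℕ) → (∀ {S T} → S ⊆ T → w T ≤ w S) →
               ∀ j → suc j * level w (suc j) + j * level w j ≤ n * level w j
level-shadow {zero} w w-anti zero    = ≤-reflexive (zeros (w []))
  where
  zeros : ∀ x → 1 * (x * 0) + 0 ≡ 0
  zeros = solve-∀
level-shadow {zero} w w-anti (suc j) = ≤-reflexive (zeros (w []) j)
  where
  zeros : ∀ x j → suc (suc j) * (x * 0) + suc j * (x * 0) ≡ 0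
  zeros = solve-∀
level-shadow {suc n} w w-anti = go
  where
  open ≤-Reasoning
  a b : ℕ → ℕ
  a = level (w ∘ (inside ∷_))
  b = level (w ∘ (outside ∷_))
  a≤b : ∀ j → a j ≤ b j
  a≤b j = ∑-mono {n} λ S → *-monoˡ-≤ ⟦ ∣ S ∣ ≡ᵇ j ⟧ (w-anti {outside ∷ S} {inside ∷ S} (out⊆ λ x∈S → x∈S))
  IHa : ∀ j → suc j * a (suc j) + j * a j ≤ n * a j
  IHa = level-shadow (w ∘ (inside ∷_)) (λ S⊆T → w-anti (in⊆in S⊆T))
  IHb : ∀ j → suc j * b (suc j) + j * b j ≤ n * b j
  IHb = level-shadow (w ∘ (outside ∷_)) (λ S⊆T → w-anti (out⊆ S⊆T))
  regroup₀ : ∀ x y → 1 * (x + y) + 0 ≡ x + (1 * y + 0)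
  regroup₀ = solve-∀
  regroup : ∀ j x y z t → suc (suc j) * (x + y) + suc j * (z + t) ≡
            x + ((suc j * x + j * z) + z) + (suc (suc j) * y + suc j * t)
  regroup = solve-∀
  collect : ∀ n z t → t + (n * z + z) + n * t ≡ suc n * (z + t)
  collect = solve-∀
  go : ∀ j → suc j * level w (suc j) + j * level w j ≤ suc n * level w j
  go zero = begin
    1 * (a 0 + b 1) + 0   ≡⟨ regroup₀ (a 0) (b 1) ⟩
    a 0 + (1 * b 1 + 0)   ≤⟨ +-mono-≤ (a≤b 0) (IHb 0) ⟩
    suc n * b 0           ≡⟨ cong (λ z → suc n * (z + b 0)) (level-inside-0 w) ⟨
    suc n * level w 0     ∎
  go (suc j) = begin
    suc (suc j) * (a (suc j) + b (suc (suc j))) + suc j * (a j + b (suc j))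
      -- One of the `j + 2` copies of `a (suc j)` is bounded by `b (suc j)`; the other `j + 1`,
      -- together with `j` copies of `a j`, form the left side of `IHa`.
      ≡⟨ regroup j (a (suc j)) (b (suc (suc j))) (a j) (b (suc j)) ⟩
    a (suc j) + ((suc j * a (suc j) + j * a j) + a j)
      + (suc (suc j) * b (suc (suc j)) + suc j * b (suc j))
      ≤⟨ +-mono-≤ (+-mono-≤ (a≤b (suc j)) (+-monoˡ-≤ (a j) (IHa j))) (IHb (suc j)) ⟩
    b (suc j) + (n * a j + a j) + n * b (suc j)
      ≡⟨ collect n (a j) (b (suc j)) ⟩
    suc n * (a j + b (suc j)) ∎

-- The weight `(n ∸ j) !` absorbs the factor n-j of the shadow bound, leaving only the constant
-- `suc j`. The instances `j = 1` and `j = 2` yield the two hypotheses on the cubic.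
level-shadow-! : ∀ {n} (w : Subset n → ℕ) → (∀ {S T} → S ⊆ T → w T ≤ w S) →
  ∀ j → suc j * (level w (suc j) * (n ∸ suc j) !) ≤ level w j * (n ∸ j) !
level-shadow-! {n} w w-anti j with j <? n
... | yes j<n = begin
  suc j * (l₁ * (n ∸ suc j) !)        ≡⟨ *-assoc (suc j) l₁ _ ⟨
  suc j * l₁ * (n ∸ suc j) !          ≤⟨ *-monoˡ-≤ _ step ⟩
  suc (n ∸ suc j) * l₀ * (n ∸ suc j) ! ≡⟨ swap (suc (n ∸ suc j)) l₀ _ ⟩
  l₀ * suc (n ∸ suc j) !              ≡⟨ cong (λ m → l₀ * m !) ∸-suc ⟨
  l₀ * (n ∸ j) !                      ∎
  where
  open ≤-Reasoning
  l₀ = level w j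
  l₁ = level w (suc j)
  swap : ∀ x y z → x * y * z ≡ y * (x * z)
  swap = solve-∀
  ∸-suc : n ∸ j ≡ suc (n ∸ suc j)
  ∸-suc = +-∸-assoc 1 j<n
  step : suc j * l₁ ≤ suc (n ∸ suc j) * l₀
  step = +-cancelʳ-≤ (j * l₀) _ _ (begin
    suc j * l₁ + j * l₀               ≤⟨ level-shadow w w-anti j ⟩
    n * l₀                            ≡⟨ cong (_* l₀) (m∸n+n≡m (<⇒≤ j<n)) ⟨
    (n ∸ j + j) * l₀                  ≡⟨ *-distribʳ-+ l₀ (n ∸ j) j ⟩
    (n ∸ j) * l₀ + j * l₀             ≡⟨ cong (λ m → m * l₀ + j * l₀) ∸-suc ⟩
    suc (n ∸ suc j) * l₀ + j * l₀     ∎)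
-- For `n ≤ j` both factorials are 0! and supply no factor n-j. Instead the shadow bound itself
-- forces `suc j * l₁` to vanish.
... | no j≮n = ≤-trans
  (≤-reflexive (trans (sym (*-assoc (suc j) l₁ _)) (cong (_* (n ∸ suc j) !) vanish))) z≤n
  where
  open ≤-Reasoning
  l₀ = level w j
  l₁ = level w (suc j)
  vanish : suc j * l₁ ≡ 0
  vanish = n≤0⇒n≡0 (+-cancelʳ-≤ (j * l₀) _ 0 (begin
    suc j * l₁ + j * l₀ ≤⟨ level-shadow w w-anti j ⟩
    n * l₀              ≤⟨ *-monoˡ-≤ l₀ (≮⇒≥ j≮n) ⟩
    j * l₀              ∎))

-- Splitting on whether a point of `T` is chosen is Pascal's rule; a point outside `T` contributes
-- nothing when chosen.
level-subsets : ∀ {n} (T : Subset n) m → level (λ S → ⟦ does (S ⊆? T) ⟧) m ≡ ∣ T ∣ C m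
level-subsets []           zero       = refl
level-subsets []           (suc m)    = refl
level-subsets {suc n} (outside ∷ T) m =
  cong₂ _+_ (∑-0 {n} λ _ → refl) (level-subsets T m)
level-subsets (inside ∷ T) zero       =
  cong₂ _+_ (level-inside-0 λ S → ⟦ does (S ⊆? inside ∷ T) ⟧) (level-subsets T 0)
level-subsets (inside ∷ T) (suc m)    =
  trans (cong₂ _+_ (level-subsets T m) (level-subsets T (suc m)))
        (nCk+nC[k+1]≡[n+1]C[k+1] ∣ T ∣ m)

-- Binomial coefficients

-- The absorption identity: Pascal's rule splits the coefficient, induction absorbs both parts with
-- one copy of `suc n C suc k` set aside, and Pascal's rule recombines them.
[1+k]*[1+n]C[1+k] : ∀ n k → suc k * (suc n C suc k) ≡ suc n * (n C k)
[1+k]*[1+n]C[1+k] n       zero    =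
  trans (*-identityˡ (suc n C 1)) (trans (nC1≡n (suc n)) (sym (*-identityʳ (suc n))))
[1+k]*[1+n]C[1+k] zero    (suc k) = *-zeroʳ k
[1+k]*[1+n]C[1+k] (suc n) (suc k) = begin
  suc (suc k) * (suc (suc n) C suc (suc k))
    ≡⟨ cong (suc (suc k) *_) (nCk+nC[k+1]≡[n+1]C[k+1] (suc n) (suc k)) ⟨
  suc (suc k) * (suc n C suc k + suc n C suc (suc k))
    ≡⟨ expand k (suc n C suc k) (suc n C suc (suc k)) ⟩
  suc n C suc k + (suc k * (suc n C suc k) + suc (suc k) * (suc n C suc (suc k)))
    ≡⟨ cong (suc n C suc k +_) (cong₂ _+_ ([1+k]*[1+n]C[1+k] n k) ([1+k]*[1+n]C[1+k] n (suc k))) ⟩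
  suc n C suc k + (suc n * (n C k) + suc n * (n C suc k))
    ≡⟨ cong (suc n C suc k +_) (*-distribˡ-+ (suc n) (n C k) (n C suc k)) ⟨
  suc n C suc k + suc n * (n C k + n C suc k)
    ≡⟨ cong (λ c → suc n C suc k + suc n * c) (nCk+nC[k+1]≡[n+1]C[k+1] n k) ⟩
  suc (suc n) * (suc n C suc k) ∎
  where
  open ≡-Reasoning
  expand : ∀ k x y → suc (suc k) * (x + y) ≡ x + (suc k * x + suc (suc k) * y)
  expand = solve-∀

-- The ratio of consecutive binomial coefficients, with the term `k * (n C k)` moved to the left so
-- that no truncated subtraction occurs and `k > n` is covered.
[1+k]*nC[1+k]+k*nCk : ∀ n k → suc k * (n C suc k) + k * (n C k) ≡ n * (n C k)
[1+k]*nC[1+k]+k*nCk zero k = cong₂ _+_ (*-zeroʳ k) (vanish k)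
  where
  vanish : ∀ k → k * (0 C k) ≡ 0
  vanish zero    = refl
  vanish (suc k) = *-zeroʳ k
[1+k]*nC[1+k]+k*nCk (suc n) zero    = trans (+-identityʳ (1 * (suc n C 1))) ([1+k]*[1+n]C[1+k] n 0)
[1+k]*nC[1+k]+k*nCk (suc n) (suc k) = begin
  suc (suc k) * (suc n C suc (suc k)) + suc k * (suc n C suc k)
    ≡⟨ cong₂ _+_ ([1+k]*[1+n]C[1+k] n (suc k)) ([1+k]*[1+n]C[1+k] n k) ⟩
  suc n * (n C suc k) + suc n * (n C k)
    ≡⟨ *-distribˡ-+ (suc n) (n C suc k) (n C k) ⟨
  suc n * (n C suc k + n C k)
    ≡⟨ cong (suc n *_) (trans (+-comm (n C suc k) (n C k)) (nCk+nC[k+1]≡[n+1]C[k+1] n k)) ⟩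
  suc n * (suc n C suc k) ∎
  where open ≡-Reasoning

-- Evaluating `n * c₀ * c₁` by the ratio identity at `i` and at `suc i` gives (i+2)c₀c₂ + (i+1)c₀c₁
-- = (i+1)c₁² + i c₀c₁, whence (i+2)c₀c₂ ≤ (i+1)c₁².
C-logConcave : ∀ n i → (n C i) * (n C (2 + i)) ≤ (n C (1 + i)) * (n C (1 + i))
C-logConcave n i = *-cancelˡ-≤ (suc (suc i)) (begin
  suc (suc i) * (c₀ * c₂)   ≤⟨ +-cancelʳ-≤ (i * (c₀ * c₁)) _ _ bound ⟩
  suc i * (c₁ * c₁)         ≤⟨ *-monoˡ-≤ (c₁ * c₁) (n≤1+n (suc i)) ⟩
  suc (suc i) * (c₁ * c₁)   ∎)
  where
  open ≤-Reasoning
  c₀ = n C i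
  c₁ = n C (1 + i)
  c₂ = n C (2 + i)
  r₁ : ∀ i x y z → suc (suc i) * (x * z) + suc i * (x * y) ≡ x * (suc (suc i) * z + suc i * y)
  r₁ = solve-∀
  r₂ : ∀ n x y → x * (n * y) ≡ y * (n * x)
  r₂ = solve-∀
  r₃ : ∀ i x y → y * (suc i * y + i * x) ≡ suc i * (y * y) + i * (x * y)
  r₃ = solve-∀
  bound : suc (suc i) * (c₀ * c₂) + i * (c₀ * c₁) ≤ suc i * (c₁ * c₁) + i * (c₀ * c₁)
  bound = begin
    suc (suc i) * (c₀ * c₂) + i * (c₀ * c₁)
      ≤⟨ +-monoʳ-≤ (suc (suc i) * (c₀ * c₂)) (*-monoˡ-≤ (c₀ * c₁) (n≤1+n i)) ⟩
    suc (suc i) * (c₀ * c₂) + suc i * (c₀ * c₁) ≡⟨ r₁ i c₀ c₁ c₂ ⟩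
    c₀ * (suc (suc i) * c₂ + suc i * c₁)        ≡⟨ cong (c₀ *_) ([1+k]*nC[1+k]+k*nCk n (suc i)) ⟩
    c₀ * (n * c₁)                               ≡⟨ r₂ n c₀ c₁ ⟩
    c₁ * (n * c₀)                               ≡⟨ cong (c₁ *_) ([1+k]*nC[1+k]+k*nCk n i) ⟨
    c₁ * (suc i * c₁ + i * c₀)                  ≡⟨ r₃ i c₀ c₁ ⟩
    suc i * (c₁ * c₁) + i * (c₀ * c₁)           ∎

-- With n = a+r and k = a+m, this trades C(n-a,k-a) for C(n,k) times a falling factorial in k. Each
-- increment of `a` is one use of absorption.
[a+r]!*rCm : ∀ a r m → (a + r) ! * (r C m) ≡ ((a + r) C (a + m)) * (r ! * ((a + m) P′ a))
[a+r]!*rCm zero    r m = trans (*-comm (r !) (r C m)) (cong ((r C m) *_) (sym (*-identityʳ (r !))))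
[a+r]!*rCm (suc a) r m = begin
  suc N * N ! * (r C m)                        ≡⟨ *-assoc (suc N) (N !) (r C m) ⟩
  suc N * (N ! * (r C m))                      ≡⟨ cong (suc N *_) ([a+r]!*rCm a r m) ⟩
  suc N * ((N C K) * (r ! * (K P′ a)))         ≡⟨ *-assoc (suc N) (N C K) _ ⟨
  suc N * (N C K) * (r ! * (K P′ a))           ≡⟨ cong (_* (r ! * (K P′ a))) ([1+k]*[1+n]C[1+k] N K) ⟨
  suc K * (suc N C suc K) * (r ! * (K P′ a))
    ≡⟨ regroup (suc K) (suc N C suc K) (r !) (K P′ a) ⟩
  (suc N C suc K) * (r ! * (suc K * (K P′ a)))
    ≡⟨ cong (λ p → (suc N C suc K) * (r ! * p)) (nP′k≡n[n∸1P′k∸1] (suc K) (suc a)) ⟨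
  (suc N C suc K) * (r ! * (suc K P′ suc a))   ∎
  where
  open ≡-Reasoning
  N = a + r
  K = a + m
  regroup : ∀ x y z t → x * y * (z * t) ≡ y * (z * (x * t))
  regroup = solve-∀

-- Log-concavity of the cubic

nP′k≡0 : ∀ {n k} → n < k → n P′ k ≡ 0
nP′k≡0 {n} {suc k} (s≤s n≤k) = cong (_* (n P′ k)) (m≤n⇒m∸n≡0 n≤k)

-- The discrete power rule: the forward difference of a falling factorial, from which the
-- differences of the cubic are read off.
[1+n]P′[1+k] : ∀ n k → suc n P′ suc k ≡ n P′ suc k + suc k * (n P′ k)
[1+n]P′[1+k] n k = trans (nP′k≡n[n∸1P′k∸1] (suc n) (suc k)) (split (k ≤? n))
  where
  split : Dec (k ≤ n) → suc n * (n P′ k) ≡ (n ∸ k) * (n P′ k) + suc k * (n P′ k)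
  split (yes k≤n) = trans
    (cong (_* (n P′ k)) (sym (trans (+-suc (n ∸ k) k) (cong suc (m∸n+n≡m k≤n)))))
    (*-distribʳ-+ (n P′ k) (n ∸ k) (suc k))
  -- Here the truncated `n ∸ k` and `suc k` need not add up to `suc n`, but both sides vanish with
  -- `n P′ k`.
  split (no k≰n) rewrite nP′k≡0 (≰⇒> k≰n) =
    trans (*-zeroʳ n) (sym (cong₂ _+_ (*-zeroʳ (n ∸ k)) (*-zeroʳ k)))

2mn≤m²+n² : ∀ m n → 2 * (m * n) ≤ m * m + n * n
2mn≤m²+n² m n = [ ordered m n , flipped ]′ (≤-total m n)
  where
  open ≤-Reasoning
  square : ∀ m d → 2 * (m * (m + d)) + d * d ≡ m * m + (m + d) * (m + d)
  square = solve-∀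
  ordered : ∀ m n → m ≤ n → 2 * (m * n) ≤ m * m + n * n
  ordered m n m≤n with m≤n⇒∃[o]m+o≡n m≤n
  ... | d , refl = ≤-trans (m≤m+n _ (d * d)) (≤-reflexive (square m d))
  flipped : n ≤ m → 2 * (m * n) ≤ m * m + n * n
  flipped n≤m = subst₂ _≤_ (cong (2 *_) (*-comm n m)) (+-comm (n * n) (m * m)) (ordered n m n≤m)

module Cubic (a b c : ℕ) (2b≤a : 2 * b ≤ a) (3c≤b : 3 * c ≤ b) where
  open ≤-Reasoning

  -- Written in falling factorials, so that the first and second forward differences of `f` have the
  -- closed forms `Δf` and `Δ²f`.
  f Δf Δ²f : ℕ → ℕ
  f   k = a * (1 + k) + b * (k P′ 2) + c * (k P′ 3)
  Δf  k = a + 2 * b * k + 3 * c * (k P′ 2)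
  Δ²f k = 2 * b + 6 * c * k

  f-suc : ∀ k → f (suc k) ≡ f k + Δf k
  f-suc k = trans
    (cong₂ (λ p q → a * (2 + k) + b * p + c * q) ([1+n]P′[1+k] k 1) ([1+n]P′[1+k] k 2))
    (expand a b c k (k P′ 2) (k P′ 3))
    where
    expand : ∀ a b c k p q → a * (2 + k) + b * (p + 2 * (k * 1)) + c * (q + 3 * p) ≡
             (a * (1 + k) + b * p + c * q) + (a + 2 * b * k + 3 * c * p)
    expand = solve-∀

  Δf-suc : ∀ k → Δf (suc k) ≡ Δf k + Δ²f k
  Δf-suc k = trans (cong (λ p → a + 2 * b * suc k + 3 * c * p) ([1+n]P′[1+k] k 1))
                   (expand a b c k (k P′ 2))
    where
    expand : ∀ a b c k p → a + 2 * b * suc k + 3 * c * (p + 2 * (k * 1)) ≡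
             (a + 2 * b * k + 3 * c * p) + (2 * b + 6 * c * k)
    expand = solve-∀

  -- An equivalent form of log-concavity: with x, y, z the values of `f`, `Δf`, `Δ²f` at `k`, the
  -- inequality x(x+2y+z) ≤ (x+y)² says xz ≤ y². At `k = 0` it reduces to `2 * b ≤ a`.
  f*Δ²f≤Δf² : ∀ k → f k * Δ²f k ≤ Δf k * Δf k
  f*Δ²f≤Δf² zero = begin
    f 0 * Δ²f 0             ≡⟨ at-0 a b c ⟩
    a * (2 * b)             ≤⟨ *-monoʳ-≤ a 2b≤a ⟩
    a * a                   ≡⟨ at-0′ a b c ⟨
    Δf 0 * Δf 0             ∎
    where
    at-0 : ∀ a b c → (a * 1 + b * 0 + c * 0) * (2 * b + 6 * c * 0) ≡ a * (2 * b)
    at-0 = solve-∀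
    at-0′ : ∀ a b c → (a + 2 * b * 0 + 3 * c * 0) * (a + 2 * b * 0 + 3 * c * 0) ≡ a * a
    at-0′ = solve-∀
  -- The terms 2ab(2+j) and 12ac(1+j) of the left-hand side are bounded by
  -- a² + b²(2+j)² and 4ab(1+j).
  f*Δ²f≤Δf² (suc j) = begin
    f (suc j) * Δ²f (suc j)
      -- The factor `j ∸ 1` of `suc j P′ 3` is enlarged to `j`, which removes truncated subtraction
      -- before the ring solver is applied.
      ≤⟨ *-monoˡ-≤ (Δ²f (suc j)) (+-monoʳ-≤ (a * (2 + j) + b * (suc j P′ 2))
           (*-monoʳ-≤ c (*-monoˡ-≤ (suc j P′ 2) (m∸n≤m j 1)))) ⟩
    (a * (2 + j) + b * (j * (suc j * 1)) + c * (j * (j * (suc j * 1)))) * Δ²f (suc j)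
      ≡⟨ separate a b c j ⟩
    2 * (a * (b * (2 + j))) + 4 * a * suc j * (3 * c) + rest
      ≤⟨ +-monoˡ-≤ rest (+-mono-≤ (2mn≤m²+n² a (b * (2 + j))) (*-monoʳ-≤ (4 * a * suc j) 3c≤b)) ⟩
    a * a + b * (2 + j) * (b * (2 + j)) + 4 * a * suc j * b + rest
      ≤⟨ m≤m+n _ slack ⟩
    a * a + b * (2 + j) * (b * (2 + j)) + 4 * a * suc j * b + rest + slack
      ≡⟨ total a b c j ⟩
    Δf (suc j) * Δf (suc j) ∎
    where
    p = j * suc j
    rest = 6 * a * c * p + 2 * b * b * p + 6 * b * c * suc j * p + 2 * b * c * j * p + 6 * c * c * p * p
    -- The exact difference between `Δf (suc j)` squared and the bound reached so far; its
    -- coefficients are nonnegative.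
    slack = b * b * j * (2 + j) + b * c * p * (6 + 4 * j) + 3 * c * c * p * p
    separate : ∀ a b c j →
      (a * (2 + j) + b * (j * (suc j * 1)) + c * (j * (j * (suc j * 1)))) * (2 * b + 6 * c * suc j) ≡
      2 * (a * (b * (2 + j))) + 4 * a * suc j * (3 * c)
      + (6 * a * c * (j * suc j) + 2 * b * b * (j * suc j) + 6 * b * c * suc j * (j * suc j)
         + 2 * b * c * j * (j * suc j) + 6 * c * c * (j * suc j) * (j * suc j))
    separate = solve-∀
    total : ∀ a b c j →
      a * a + b * (2 + j) * (b * (2 + j)) + 4 * a * suc j * b
      + (6 * a * c * (j * suc j) + 2 * b * b * (j * suc j) + 6 * b * c * suc j * (j * suc j)
         + 2 * b * c * j * (j * suc j) + 6 * c * c * (j * suc j) * (j * suc j))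
      + (b * b * j * (2 + j) + b * c * (j * suc j) * (6 + 4 * j) + 3 * c * c * (j * suc j) * (j * suc j)) ≡
      (a + 2 * b * suc j + 3 * c * (j * (suc j * 1))) * (a + 2 * b * suc j + 3 * c * (j * (suc j * 1)))
    total = solve-∀

  f-logConcave : ∀ k → f k * f (2 + k) ≤ f (1 + k) * f (1 + k)
  f-logConcave k = begin
    x * f (2 + k)                       ≡⟨ cong (x *_) (trans (f-suc (suc k)) (cong₂ _+_ (f-suc k) (Δf-suc k))) ⟩
    x * (x + y + (y + z))               ≡⟨ expand x y z ⟩
    x * x + 2 * (x * y) + x * z         ≤⟨ +-monoʳ-≤ (x * x + 2 * (x * y)) (f*Δ²f≤Δf² k) ⟩
    x * x + 2 * (x * y) + y * y         ≡⟨ square x y ⟩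
    (x + y) * (x + y)                   ≡⟨ cong₂ _*_ (f-suc k) (f-suc k) ⟨
    f (1 + k) * f (1 + k)               ∎
    where
    x = f k
    y = Δf k
    z = Δ²f k
    expand : ∀ x y z → x * (x + y + (y + z)) ≡ x * x + 2 * (x * y) + x * z
    expand = solve-∀
    square : ∀ x y → x * x + 2 * (x * y) + y * y ≡ (x + y) * (x + y)
    square = solve-∀

-- Stable sets of G and G*

-- Lets two weights be exchanged in a level sum when they agree only on sets of the size in
-- question.
⟦≡ᵇ⟧-cong : ∀ m k {x y} → (m ≡ k → x ≡ y) → x * ⟦ m ≡ᵇ k ⟧ ≡ y * ⟦ m ≡ᵇ k ⟧
⟦≡ᵇ⟧-cong m k {x} {y} x≡y with m ≡ᵇ k | ≡ᵇ⇒≡ m k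
... | true  | m≡k = cong (_* 1) (x≡y (m≡k _))
... | false | _   = trans (*-zeroʳ x) (sym (*-zeroʳ y))

+-≡ᵇ : ∀ a m n → (a + m ≡ᵇ a + n) ≡ (m ≡ᵇ n)
+-≡ᵇ zero    m n = refl
+-≡ᵇ (suc a) m n = +-≡ᵇ a m n

k<a⇒⟦a+m≡ᵇk⟧≡0 : ∀ {a k} m → k < a → ⟦ a + m ≡ᵇ k ⟧ ≡ 0
k<a⇒⟦a+m≡ᵇk⟧≡0 {suc a} {zero}  m _         = refl
k<a⇒⟦a+m≡ᵇk⟧≡0 {suc a} {suc k} m (s≤s k<a) = k<a⇒⟦a+m≡ᵇk⟧≡0 m k<a

∣p++q∣≡∣p∣+∣q∣ : ∀ {m n} (p : Subset m) (q : Subset n) → ∣ p ++ q ∣ ≡ ∣ p ∣ + ∣ q ∣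
∣p++q∣≡∣p∣+∣q∣ []            q = refl
∣p++q∣≡∣p∣+∣q∣ (inside  ∷ p) q = cong suc (∣p++q∣≡∣p∣+∣q∣ p q)
∣p++q∣≡∣p∣+∣q∣ (outside ∷ p) q = ∣p++q∣≡∣p∣+∣q∣ p q

∣p∣≤1⇒x≡y : ∀ {n} {p : Subset n} {x y} → ∣ p ∣ ≤ 1 → x ∈ p → y ∈ p → x ≡ y
∣p∣≤1⇒x≡y {p = p} {x} {y} ∣p∣≤1 x∈p y∈p with x ≟ y
... | yes x≡y = x≡y
-- If `x` and `y` differ, `x` survives in `p - y`, so `p` has at least two elements.
... | no  x≢y = contradiction
  (<-≤-trans (s≤s (≤-trans (s≤s z≤n) (x∈p⇒∣p-x∣<∣p∣ (x∈p∧x≢y⇒x∈p-y x∈p x≢y))))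
             (≤-trans (x∈p⇒∣p-x∣<∣p∣ y∈p) ∣p∣≤1))
  (<-irrefl refl)

-- The sum is C(n-|A|,k-|A|), since `B` ranges over subsets of the complement of `A`. On the right,
-- `n C k` no longer depends on `A`. When |A| > k no `B` qualifies, and the falling factorial
-- vanishes as well.
disjointCount : ∀ {n} (A : Subset n) k →
  n ! * ∑ (λ B → ⟦ does (B ⊆? ∁ A) ⟧ * ⟦ ∣ A ∣ + ∣ B ∣ ≡ᵇ k ⟧) ≡
  (n C k) * ((n ∸ ∣ A ∣) ! * (k P′ ∣ A ∣))
disjointCount {n} A k with ∣ A ∣ ≤? k
... | no ∣A∣≰k = trans
  (trans (cong (n ! *_) (∑-0 λ B → trans
            (cong (⟦ does (B ⊆? ∁ A) ⟧ *_) (k<a⇒⟦a+m≡ᵇk⟧≡0 ∣ B ∣ (≰⇒> ∣A∣≰k)))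
            (*-zeroʳ ⟦ does (B ⊆? ∁ A) ⟧)))
         (*-zeroʳ (n !)))
  (sym (trans (cong (λ p → (n C k) * ((n ∸ ∣ A ∣) ! * p)) (nP′k≡0 (≰⇒> ∣A∣≰k)))
              (trans (cong ((n C k) *_) (*-zeroʳ ((n ∸ ∣ A ∣) !))) (*-zeroʳ (n C k)))))
... | yes ∣A∣≤k with m≤n⇒∃[o]m+o≡n ∣A∣≤k
...   | m , refl = begin
  n ! * ∑ (λ B → ⟦ does (B ⊆? ∁ A) ⟧ * ⟦ a + ∣ B ∣ ≡ᵇ a + m ⟧)
    ≡⟨ cong (n ! *_) (∑-cong λ B → cong (λ t → ⟦ does (B ⊆? ∁ A) ⟧ * ⟦ t ⟧) (+-≡ᵇ a ∣ B ∣ m)) ⟩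
  n ! * level (λ B → ⟦ does (B ⊆? ∁ A) ⟧) m
    ≡⟨ cong (n ! *_) (level-subsets (∁ A) m) ⟩
  n ! * (∣ ∁ A ∣ C m)
    ≡⟨ cong (λ r → n ! * (r C m)) (∣∁p∣≡n∸∣p∣ A) ⟩
  n ! * ((n ∸ a) C m)
    ≡⟨ cong (λ n′ → n′ ! * ((n ∸ a) C m)) (m+[n∸m]≡n (∣p∣≤n A)) ⟨
  (a + (n ∸ a)) ! * ((n ∸ a) C m)
    ≡⟨ [a+r]!*rCm a (n ∸ a) m ⟩
  ((a + (n ∸ a)) C (a + m)) * ((n ∸ a) ! * ((a + m) P′ a))
    ≡⟨ cong (λ n′ → (n′ C (a + m)) * ((n ∸ a) ! * ((a + m) P′ a))) (m+[n∸m]≡n (∣p∣≤n A)) ⟩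
  (n C (a + m)) * ((n ∸ a) ! * ((a + m) P′ a)) ∎
  where
  open ≡-Reasoning
  a = ∣ A ∣

-- On a set of nonzero weight exactly one of the four size indicators is 1. This is how a stability
-- number at most 3 leads to a cubic in k.
∑-by-level : ∀ {n} (w : Subset n → ℕ) (h : ℕ → ℕ) → (∀ S → w S ≡ 0 ⊎ ∣ S ∣ ≤ 3) →
  ∑ (λ S → w S * h ∣ S ∣) ≡ level w 0 * h 0 + level w 1 * h 1 + level w 2 * h 2 + level w 3 * h 3
∑-by-level {n} w h bounded = trans (∑-cong pointwise)
  (trans (∑-+ _ (term 3)) (cong₂ _+_
    (trans (∑-+ _ (term 2)) (cong₂ _+_
      (trans (∑-+ (term 0) (term 1)) (cong₂ _+_ (∑-term 0) (∑-term 1)))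
      (∑-term 2)))
    (∑-term 3)))
  where
  term : ℕ → Subset n → ℕ
  term j S = h j * (w S * ⟦ ∣ S ∣ ≡ᵇ j ⟧)
  ∑-term : ∀ j → ∑ (term j) ≡ level w j * h j
  ∑-term j = trans (∑-*ˡ {n} (h j) _) (*-comm (h j) (level w j))
  select : ∀ x m → m ≤ 3 → x * h m ≡ h 0 * (x * ⟦ m ≡ᵇ 0 ⟧) + h 1 * (x * ⟦ m ≡ᵇ 1 ⟧)
                                   + h 2 * (x * ⟦ m ≡ᵇ 2 ⟧) + h 3 * (x * ⟦ m ≡ᵇ 3 ⟧)
  select x 0 _ = lemma x (h 0) (h 1) (h 2) (h 3)
    where
    lemma : ∀ x a b c d → x * a ≡ a * (x * 1) + b * (x * 0) + c * (x * 0) + d * (x * 0)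
    lemma = solve-∀
  select x 1 _ = lemma x (h 0) (h 1) (h 2) (h 3)
    where
    lemma : ∀ x a b c d → x * b ≡ a * (x * 0) + b * (x * 1) + c * (x * 0) + d * (x * 0)
    lemma = solve-∀
  select x 2 _ = lemma x (h 0) (h 1) (h 2) (h 3)
    where
    lemma : ∀ x a b c d → x * c ≡ a * (x * 0) + b * (x * 0) + c * (x * 1) + d * (x * 0)
    lemma = solve-∀
  select x 3 _ = lemma x (h 0) (h 1) (h 2) (h 3)
    where
    lemma : ∀ x a b c d → x * d ≡ a * (x * 0) + b * (x * 0) + c * (x * 0) + d * (x * 1)
    lemma = solve-∀
  select x (suc (suc (suc (suc _)))) (s≤s (s≤s (s≤s ())))
  pointwise : ∀ S → w S * h ∣ S ∣ ≡ term 0 S + term 1 S + term 2 S + term 3 S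
  pointwise S with bounded S
  ... | inj₂ ∣S∣≤3 = select (w S) ∣ S ∣ ∣S∣≤3
  ... | inj₁ wS≡0 rewrite wS≡0 = lemma (h 0) (h 1) (h 2) (h 3)
    where
    lemma : ∀ a b c d → 0 ≡ a * 0 + b * 0 + c * 0 + d * 0
    lemma = solve-∀

stableWeight : (G : Graph) → Subset (Graph.order G) → ℕ
stableWeight G S = ⟦ does (stable? G S) ⟧

s≡level : ∀ G k → s G k ≡ level (stableWeight G) k
s≡level G k = trans
  (length-filter-filter (λ S → ∣ S ∣ ℕ.≟ k) (stable? G) (allSubsets order))
  -- The boolean of `∣ S ∣ ℕ.≟ k` computes to `∣ S ∣ ≡ᵇ k`, so the two sums match without rewriting.
  (sum-allSubsets order (λ S → stableWeight G S * ⟦ ∣ S ∣ ≡ᵇ k ⟧))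
  where open Graph G

module _ (G : Graph) where
  open Graph G

  private
    n = order
    w = stableWeight G

  stableWeight-antitone : ∀ {S T} → S ⊆ T → w T ≤ w S
  stableWeight-antitone {S} {T} S⊆T = ⟦⟧-mono (stable? G T) (stable? G S)
    λ stable u v u∈S v∈S → stable u v (S⊆T u∈S) (S⊆T v∈S)

  ∣S∣≤1⇒Stable : ∀ {S} → ∣ S ∣ ≤ 1 → Stable G S
  ∣S∣≤1⇒Stable ∣S∣≤1 u v u∈S v∈S uv =
    loopless u (subst (Adj u) (sym (∣p∣≤1⇒x≡y ∣S∣≤1 u∈S v∈S)) uv)

  Stable⇒∣S∣≤α : ∀ {S} → Stable G S → ∣ S ∣ ≤ α G
  Stable⇒∣S∣≤α {S} stable = All.lookup (xs≤max 0 (List.map ∣_∣ (stableSets G)))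
    (∈-map⁺ ∣_∣ (∈-filter⁺ (stable? G) (∈-allSubsets S) stable))

  -- Yields s₀ = 1 and s₁ = n together: sets of at most one vertex are stable, so on them stability
  -- can be replaced by inclusion in `⊤`.
  level-≤1 : ∀ j → j ≤ 1 → level w j ≡ n C j
  level-≤1 j j≤1 = begin
    level w j                              ≡⟨ ∑-cong {n} agree ⟩
    level {n} (λ S → ⟦ does (S ⊆? ⊤) ⟧) j  ≡⟨ level-subsets (⊤ {n}) j ⟩
    ∣ ⊤ {n} ∣ C j                          ≡⟨ cong (_C j) (∣⊤∣≡n n) ⟩
    n C j                                  ∎
    where
    open ≡-Reasoning
    agree : ∀ S → w S * ⟦ ∣ S ∣ ≡ᵇ j ⟧ ≡ ⟦ does (S ⊆? ⊤) ⟧ * ⟦ ∣ S ∣ ≡ᵇ j ⟧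
    agree S = ⟦≡ᵇ⟧-cong ∣ S ∣ j λ ∣S∣≡j → cong ⟦_⟧ (trans
      (dec-true (stable? G S) (∣S∣≤1⇒Stable (subst (_≤ 1) (sym ∣S∣≡j) j≤1)))
      (sym (dec-true (S ⊆? ⊤) ⊆⊤)))

  -- Decomposition of the stable sets of G*

  module _ (A B : Subset n) where

    In : Fin n ⊎ Fin n → Set
    In = [ _∈ A , _∈ B ]′

    ∈-++⇔In : ∀ x → x ∈ A ++ B ⇔ In (splitAt n x)
    ∈-++⇔In x = mk⇔
      (λ x∈ → to (splitAt n x) (trans (sym (lookup-splitAt n A B x)) ([]=⇒lookup x∈)))
      (λ x∈ → lookup⇒[]= x (A ++ B) (trans (lookup-splitAt n A B x) (from (splitAt n x) x∈)))
      where
      to : ∀ y → [ Vec.lookup A , Vec.lookup B ]′ y ≡ inside → In y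
      to (inj₁ v) = lookup⇒[]= v A
      to (inj₂ v) = lookup⇒[]= v B
      from : ∀ y → In y → [ Vec.lookup A , Vec.lookup B ]′ y ≡ inside
      from (inj₁ v) = []=⇒lookup
      from (inj₂ v) = []=⇒lookup

    -- Here `B` records the v whose pendant v′ is chosen. The only neighbour of v′ is v, so the
    -- pendants impose just disjointness from `A`.
    stable-*ᴳ : Stable (G *ᴳ) (A ++ B) ⇔ (Stable G A × B ⊆ ∁ A)
    stable-*ᴳ = mk⇔ to from
      where
      to : Stable (G *ᴳ) (A ++ B) → Stable G A × B ⊆ ∁ A
      to stable = (λ u v → onSum (inj₁ u) (inj₁ v))
                , λ {v} v∈B → x∉p⇒x∈∁p λ v∈A → onSum (inj₁ v) (inj₂ v) v∈A v∈B refl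
        where
        onSum : ∀ x y → In x → In y → ¬ Adj⊎ G x y
        onSum x y x∈ y∈ xy = stable (join n n x) (join n n y)
          (Equivalence.from (∈-++⇔In _) (subst In (sym (splitAt-join n n x)) x∈))
          (Equivalence.from (∈-++⇔In _) (subst In (sym (splitAt-join n n y)) y∈))
          (subst₂ (Adj⊎ G) (sym (splitAt-join n n x)) (sym (splitAt-join n n y)) xy)
      from : Stable G A × B ⊆ ∁ A → Stable (G *ᴳ) (A ++ B)
      from (stable , B⊆∁A) x y x∈ y∈ = onSum (splitAt n x) (splitAt n y)
        (Equivalence.to (∈-++⇔In x) x∈) (Equivalence.to (∈-++⇔In y) y∈)
        where
        onSum : ∀ x y → In x → In y → ¬ Adj⊎ G x y
        onSum (inj₁ u) (inj₁ v) u∈A v∈A uv   = stable u v u∈A v∈A uv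
        onSum (inj₁ u) (inj₂ .u) u∈A u∈B refl = x∈∁p⇒x∉p (B⊆∁A u∈B) u∈A
        onSum (inj₂ u) (inj₁ .u) u∈B u∈A refl = x∈∁p⇒x∉p (B⊆∁A u∈B) u∈A
        onSum (inj₂ _) (inj₂ _) _ _ ()

    stableWeight-*ᴳ : stableWeight (G *ᴳ) (A ++ B) ≡ w A * ⟦ does (B ⊆? ∁ A) ⟧
    stableWeight-*ᴳ = trans
      (cong ⟦_⟧ (does-⇔ stable-*ᴳ (stable? (G *ᴳ) (A ++ B)) (stable? G A ×-dec B ⊆? ∁ A)))
      (⟦⟧-× (stable? G A) (B ⊆? ∁ A))

  -- Stable sets of G* are grouped by their trace `A` on G. `disjointCount` evaluates each group,
  -- and its factor `n C k` comes out of the sum.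
  n!*s-*ᴳ : ∀ k → n ! * s (G *ᴳ) k ≡
            (n C k) * ∑ λ A → w A * ((n ∸ ∣ A ∣) ! * (k P′ ∣ A ∣))
  n!*s-*ᴳ k = begin
    n ! * s (G *ᴳ) k
      ≡⟨ cong (n ! *_) (trans (s≡level (G *ᴳ) k) (∑-++ n {n} _)) ⟩
    n ! * ∑ {n} (λ A → ∑ {n} λ B → stableWeight (G *ᴳ) (A ++ B) * ⟦ ∣ A ++ B ∣ ≡ᵇ k ⟧)
      ≡⟨ cong (n ! *_) (∑-cong {n} λ A → trans (∑-cong {n} (factor A)) (∑-*ˡ {n} (w A) _)) ⟩
    n ! * ∑ (λ A → w A * extensions A)
      ≡⟨ ∑-*ˡ {n} (n !) _ ⟨
    ∑ (λ A → n ! * (w A * extensions A))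
      ≡⟨ ∑-cong {n} (λ A → trans (swap (n !) (w A) _)
           (trans (cong (w A *_) (disjointCount A k)) (swap (w A) (n C k) _))) ⟩
    ∑ (λ A → (n C k) * (w A * ((n ∸ ∣ A ∣) ! * (k P′ ∣ A ∣))))
      ≡⟨ ∑-*ˡ {n} (n C k) _ ⟩
    (n C k) * ∑ (λ A → w A * ((n ∸ ∣ A ∣) ! * (k P′ ∣ A ∣))) ∎
    where
    open ≡-Reasoning
    extensions : Subset n → ℕ
    extensions A = ∑ λ B → ⟦ does (B ⊆? ∁ A) ⟧ * ⟦ ∣ A ∣ + ∣ B ∣ ≡ᵇ k ⟧
    factor : ∀ A B → stableWeight (G *ᴳ) (A ++ B) * ⟦ ∣ A ++ B ∣ ≡ᵇ k ⟧ ≡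
                     w A * (⟦ does (B ⊆? ∁ A) ⟧ * ⟦ ∣ A ∣ + ∣ B ∣ ≡ᵇ k ⟧)
    factor A B = trans
      (cong₂ (λ x m → x * ⟦ m ≡ᵇ k ⟧) (stableWeight-*ᴳ A B) (∣p++q∣≡∣p∣+∣q∣ A B))
      (*-assoc (w A) _ _)
    swap : ∀ x y z → x * (y * z) ≡ y * (x * z)
    swap = solve-∀

  -- Stability number at most 3

  module _ (α≤3 : α G ≤ 3) where

    private
      b c : ℕ
      b = level w 2 * (n ∸ 2) !
      c = level w 3 * (n ∸ 3) !

    -- Since s₁ = n. Nonemptiness matters: for n = 0 the left side would be 0 and the right side 1.
    level1*[n∸1]!≡n! : level w 1 * (n ∸ 1) ! ≡ n !
    level1*[n∸1]!≡n! = trans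
      (cong (_* (n ∸ 1) !) (trans (level-≤1 1 ≤-refl) (nC1≡n n))) (n*[n∸1]!≡n! nonEmpty)
      where
      n*[n∸1]!≡n! : ∀ {m} → NonZero m → m * (m ∸ 1) ! ≡ m !
      n*[n∸1]!≡n! {suc m} _ = refl

    2b≤n! : 2 * b ≤ n !
    2b≤n! = subst (2 * b ≤_) level1*[n∸1]!≡n! (level-shadow-! w stableWeight-antitone 1)

    3c≤b : 3 * c ≤ b
    3c≤b = level-shadow-! w stableWeight-antitone 2

    open Cubic (n !) b c 2b≤n! 3c≤b using (f; f-logConcave)

    n!*s-*ᴳ≡nCk*f : ∀ k → n ! * s (G *ᴳ) k ≡ (n C k) * f k
    n!*s-*ᴳ≡nCk*f k = trans (n!*s-*ᴳ k) (cong ((n C k) *_) (begin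
      ∑ (λ A → w A * h ∣ A ∣)
        ≡⟨ ∑-by-level w h bounded ⟩
      level w 0 * h 0 + level w 1 * h 1 + level w 2 * h 2 + level w 3 * h 3
        ≡⟨ cong₂ _+_ (cong₂ _+_ low (sym (*-assoc (level w 2) _ _))) (sym (*-assoc (level w 3) _ _)) ⟩
      f k ∎))
      where
      open ≡-Reasoning
      h : ℕ → ℕ
      h j = (n ∸ j) ! * (k P′ j)
      bounded : ∀ S → w S ≡ 0 ⊎ ∣ S ∣ ≤ 3
      bounded S = go (stable? G S)
        where
        go : (S? : Dec (Stable G S)) → ⟦ does S? ⟧ ≡ 0 ⊎ ∣ S ∣ ≤ 3
        go (yes stable) = inj₂ (≤-trans (Stable⇒∣S∣≤α stable) α≤3)
        go (no  _)      = inj₁ refl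
      regroup : ∀ x k → 1 * (x * 1) + x * (k * 1) ≡ x * (1 + k)
      regroup = solve-∀
      -- The coefficients s₀ n! and s₁ (n-1)! both equal n!, so sizes 0 and 1 merge into the single
      -- term a(1+k) of the cubic.
      low : level w 0 * h 0 + level w 1 * h 1 ≡ n ! * (1 + k)
      low = trans
        (cong₂ _+_ (cong (_* h 0) (level-≤1 0 z≤n))
                   (trans (sym (*-assoc (level w 1) _ _)) (cong (_* (k * 1)) level1*[n∸1]!≡n!)))
        (regroup (n !) k)

    -- Scaling by (n!)² turns each coefficient into `(n C k) * f k`, and a termwise product of
    -- nonnegative log-concave sequences is log-concave.
    s-*ᴳ-logConcave : ∀ i → s (G *ᴳ) i * s (G *ᴳ) (2 + i) ≤ s (G *ᴳ) (1 + i) * s (G *ᴳ) (1 + i)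
    s-*ᴳ-logConcave i = *-cancelˡ-≤ (n ! * n !) {{m*n≢0 (n !) (n !) {{n !≢0}} {{n !≢0}}}} (begin
      n ! * n ! * (t i * t (2 + i))               ≡⟨ exchange (n !) (n !) (t i) (t (2 + i)) ⟩
      n ! * t i * (n ! * t (2 + i))               ≡⟨ cong₂ _*_ (n!*s-*ᴳ≡nCk*f i) (n!*s-*ᴳ≡nCk*f (2 + i)) ⟩
      (n C i) * f i * ((n C (2 + i)) * f (2 + i)) ≡⟨ exchange (n C i) (f i) (n C (2 + i)) (f (2 + i)) ⟩
      (n C i) * (n C (2 + i)) * (f i * f (2 + i)) ≤⟨ *-mono-≤ (C-logConcave n i) (f-logConcave i) ⟩
      cₘ * cₘ * (fₘ * fₘ)                         ≡⟨ exchange cₘ cₘ fₘ fₘ ⟩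
      cₘ * fₘ * (cₘ * fₘ)                         ≡⟨ cong₂ _*_ (n!*s-*ᴳ≡nCk*f (1 + i)) (n!*s-*ᴳ≡nCk*f (1 + i)) ⟨
      n ! * t (1 + i) * (n ! * t (1 + i))         ≡⟨ exchange (n !) (t (1 + i)) (n !) (t (1 + i)) ⟩
      n ! * n ! * (t (1 + i) * t (1 + i))         ∎)
      where
      open ≤-Reasoning
      t = s (G *ᴳ)
      cₘ = n C (1 + i)
      fₘ = f (1 + i)
      exchange : ∀ x y z u → x * y * (z * u) ≡ x * z * (y * u)
      exchange = solve-∀

theorem4 : (G : Graph) → α G ≤ 3 → LogConcave (independencePolynomial (G *ᴳ))
theorem4 G α≤3 i j k j≡1+i k≡1+j = begin
  t (toℕ i) * t (toℕ k)         ≡⟨ cong (λ m → t (toℕ i) * t m) (trans k≡1+j (cong suc j≡1+i)) ⟩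
  t (toℕ i) * t (2 + toℕ i)     ≤⟨ s-*ᴳ-logConcave G α≤3 (toℕ i) ⟩
  t (1 + toℕ i) * t (1 + toℕ i) ≡⟨ cong (λ m → t m * t m) j≡1+i ⟨
  t (toℕ j) * t (toℕ j)         ≡⟨ cong (t (toℕ j) *_) (*-identityʳ (t (toℕ j))) ⟨
  t (toℕ j) ^ 2                 ∎
  where
  open ≤-Reasoning
  t = s (G *ᴳ)
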